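{- Let $X_n,Y_n,M_n,P_n$ and $A_n,B_n,C_n$ $(n\ge0)$ be the sequences defined in the context. For all $n\ge0$, $$X_n=B_n-A_n,\qquad Y_n=C_n-B_n,\qquad M_n=C_n-2B_n+A_n,\qquad P_n=C_n-A_n.$$
   Context: $\operatorname{mex}(S)$ is the smallest nonnegative integer not in $S$. Set $X_0=Y_0=M_0=P_0=0$ and, for $n>0$, $X_n=\operatorname{mex}\{X_i,Y_i:i<n\}$, $M_n=\operatorname{mex}\{M_i,P_i:i<n\}$, $Y_n=X_n+M_n$, $P_n=X_n+Y_n$. The Tribonacci word $\mathbf T=t_1t_2t_3\cdots$ (indexed from $1$) is the infinite fixed point, beginning with $a$, of the morphism $\tau: a\to ab,\ b\to ac,\ c\to a$. For $n\ge1$, $A_n$ (resp. $B_n$, $C_n$) is the index of the $n$th occurrence of the letter $a$ (resp. $b$, $c$) in $\mathbf T$; also $A_0=B_0=C_0=0$. -}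

module Defs where

open import Data.Empty using (⊥-elim)
open import Data.List.Base
  using (List; []; _∷_; [_]; _++_; length; concatMap; filter; applyUpTo)
open import Data.List.Membership.Propositional using () renaming (_∈_ to _∈ᴸ_)
open import Data.List.Properties
  using (concatMap-++; filter-++; length-++; length-applyUpTo; applyUpTo-∷ʳ)
open import Data.List.Relation.Unary.Any using (here; there)
open import Data.Nat.Base
open import Data.Nat.Properties hiding (_≟_)
import Data.Nat.Properties as ℕ
open import Data.List.Membership.DecPropositional ℕ._≟_ using (_∈?_)
open import Data.Product.Base using (∃; ∃-syntax; _×_; _,_; proj₁; proj₂)
open import Data.Sum.Base using (_⊎_; inj₁; inj₂)
open import Level using (0ℓ)
open import Relation.Binary.Definitions using (DecidableEquality)
open import Relation.Binary.PropositionalEquality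
  using (_≡_; refl; sym; trans; cong; cong₂; subst)
open import Relation.Nullary.Decidable using (yes; no)
open import Relation.Unary using (Pred; _∈_; _∉_)

------------------------------------------------------------------------
-- The mex recursion

IsMex : Pred ℕ 0ℓ → ℕ → Set
IsMex S m = m ∉ S × (∀ k → k ∉ S → m ≤ k)

Earlier : (U V : ℕ → ℕ) → ℕ → Pred ℕ 0ℓ
Earlier U V n k = ∃[ i ] i < n × (k ≡ U i ⊎ k ≡ V i)

record IsMexSystem (X Y M P : ℕ → ℕ) : Set where
  field
    X₀ : X 0 ≡ 0
    Y₀ : Y 0 ≡ 0
    M₀ : M 0 ≡ 0
    P₀ : P 0 ≡ 0
    Xₙ : ∀ n → 0 < n → IsMex (Earlier X Y n) (X n)
    Mₙ : ∀ n → 0 < n → IsMex (Earlier M P n) (M n)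
    Yₙ : ∀ n → 0 < n → Y n ≡ X n + M n
    Pₙ : ∀ n → 0 < n → P n ≡ X n + Y n

------------------------------------------------------------------------
-- The Tribonacci word

data Letter : Set where
  a b c : Letter

infix 4 _≟_

_≟_ : DecidableEquality Letter
a ≟ a = yes refl
a ≟ b = no λ ()
a ≟ c = no λ ()
b ≟ a = no λ ()
b ≟ b = yes refl
b ≟ c = no λ ()
c ≟ a = no λ ()
c ≟ b = no λ ()
c ≟ c = yes refl

count : Letter → List Letter → ℕ
count x xs = length (filter (x ≟_) xs)

τ : Letter → List Letter
τ a = a ∷ b ∷ []
τ b = a ∷ c ∷ []
τ c = a ∷ []

τ* : List Letter → List Letter
τ* = concatMap τ

-- The infinite word t₁ t₂ t₃ ⋯ is the function w with w j = t_{j+1}.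
InfWord : Set
InfWord = ℕ → Letter

prefix : InfWord → ℕ → List Letter
prefix = applyUpTo

-- τ(w) is the infinite word having every τ(t₁)⋯τ(tₙ) as a prefix; these
-- prefixes are arbitrarily long because τ erases no letter.  So τ(w) = w
-- says that each of them is the prefix of w of its own length.
IsFixedPoint : InfWord → Set
IsFixedPoint w = ∀ n → τ* (prefix w n) ≡ prefix w (length (τ* (prefix w n)))

IsTribonacci : InfWord → Set
IsTribonacci w = w 0 ≡ a × IsFixedPoint w

-- The nth occurrence of x in w has (1-based) index i.
IsOccurrence : InfWord → Letter → ℕ → ℕ → Set
IsOccurrence w x n i =
  ∃[ j ] i ≡ suc j × w j ≡ x × count x (prefix w i) ≡ n

record IsOccurrenceSequence (w : InfWord) (x : Letter) (f : ℕ → ℕ) : Set where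
  field
    at-zero : f 0 ≡ 0
    at-pos  : ∀ n → 0 < n → IsOccurrence w x n (f n)

------------------------------------------------------------------------
-- Existence of the objects specified above

private

  mex-search : (xs : List ℕ) (k : ℕ) →
               ∃ (IsMex (_∈ᴸ xs)) ⊎ (∀ j → j < k → j ∈ᴸ xs)
  mex-search xs zero = inj₂ λ _ ()
  mex-search xs (suc k) with mex-search xs k
  ... | inj₁ m = inj₁ m
  ... | inj₂ below with k ∈? xs
  ...   | no k∉ = inj₁ (k , k∉ , λ j j∉ → ≮⇒≥ λ j<k → j∉ (below j j<k))
  ...   | yes k∈ = inj₂ λ j j<1+k → extend (m<1+n⇒m<n∨m≡n j<1+k)
    where
    extend : ∀ {j} → j < k ⊎ j ≡ k → j ∈ᴸ xs
    extend (inj₁ j<k)  = below _ j<k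
    extend (inj₂ refl) = k∈

  total : List ℕ → ℕ
  total []       = 0
  total (x ∷ xs) = x + total xs

  ∈⇒≤total : ∀ {x xs} → x ∈ᴸ xs → x ≤ total xs
  ∈⇒≤total {xs = y ∷ ys} (here refl) = m≤m+n y (total ys)
  ∈⇒≤total {xs = y ∷ ys} (there p)   = ≤-trans (∈⇒≤total p) (m≤n+m (total ys) y)

  mex : (xs : List ℕ) → ∃ (IsMex (_∈ᴸ xs))
  mex xs with mex-search xs (suc (suc (total xs)))
  ... | inj₁ m     = m
  ... | inj₂ below = ⊥-elim (1+n≰n (∈⇒≤total (below (suc (total xs)) ≤-refl)))

  IsMex-resp : ∀ {S S′ : Pred ℕ 0ℓ} {m} → (∀ {k} → k ∈ S → k ∈ S′) →
               (∀ {k} → k ∈ S′ → k ∈ S) → IsMex S m → IsMex S′ m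
  IsMex-resp to from (m∉ , least) =
    (λ m∈ → m∉ (from m∈)) , λ k k∉ → least k (λ k∈ → k∉ (to k∈))

  -- The values listed so far: those of X and Y, and those of M and P.
  nextX nextM : List ℕ × List ℕ → ℕ
  nextX (xys , mps) = proj₁ (mex xys)
  nextM (xys , mps) = proj₁ (mex mps)

  history : ℕ → List ℕ × List ℕ
  history zero    = [] , []
  history (suc n) =
    let h = history n; x = nextX h; m = nextM h; y = x + m in
    (x ∷ y ∷ proj₁ h) , (m ∷ x + y ∷ proj₂ h)

  X′ Y′ M′ P′ : ℕ → ℕ
  X′ n = nextX (history n)
  M′ n = nextM (history n)
  Y′ n = X′ n + M′ n
  P′ n = X′ n + Y′ n

  module _ (U V : ℕ → ℕ) (h : ℕ → List ℕ) (h₀ : h 0 ≡ [])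
           (hₛ : ∀ n → h (suc n) ≡ U n ∷ V n ∷ h n) where

    history⇒Earlier : ∀ n {k} → k ∈ᴸ h n → Earlier U V n k
    history⇒Earlier zero p with () ← subst (_ ∈ᴸ_) h₀ p
    history⇒Earlier (suc n) p with subst (_ ∈ᴸ_) (hₛ n) p
    ... | here e          = n , ≤-refl , inj₁ e
    ... | there (here e)  = n , ≤-refl , inj₂ e
    ... | there (there q) with i , i<n , e ← history⇒Earlier n q =
      i , m<n⇒m<1+n i<n , e

    Earlier⇒history : ∀ n {k} → Earlier U V n k → k ∈ᴸ h n
    Earlier⇒history (suc n) (i , i<1+n , e) = subst (_ ∈ᴸ_) (sym (hₛ n))
      (split (m<1+n⇒m<n∨m≡n i<1+n) e)
      where
      split : ∀ {i k} → i < n ⊎ i ≡ n → k ≡ U i ⊎ k ≡ V i →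
              k ∈ᴸ U n ∷ V n ∷ h n
      split (inj₁ i<n)  e        = there (there (Earlier⇒history n (_ , i<n , e)))
      split (inj₂ refl) (inj₁ e) = here e
      split (inj₂ refl) (inj₂ e) = there (here e)

mexSystem-exists :
  ∃[ X ] ∃[ Y ] ∃[ M ] ∃[ P ] IsMexSystem X Y M P
mexSystem-exists = X′ , Y′ , M′ , P′ , record
  { X₀ = refl ; Y₀ = refl ; M₀ = refl ; P₀ = refl
  ; Xₙ = λ n _ → IsMex-resp
      (history⇒Earlier X′ Y′ (λ k → proj₁ (history k)) refl (λ _ → refl) n)
      (Earlier⇒history X′ Y′ (λ k → proj₁ (history k)) refl (λ _ → refl) n)
      (proj₂ (mex (proj₁ (history n))))
  ; Mₙ = λ n _ → IsMex-resp
      (history⇒Earlier M′ P′ (λ k → proj₂ (history k)) refl (λ _ → refl) n)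
      (Earlier⇒history M′ P′ (λ k → proj₂ (history k)) refl (λ _ → refl) n)
      (proj₂ (mex (proj₂ (history n))))
  ; Yₙ = λ _ _ → refl
  ; Pₙ = λ _ _ → refl
  }

private

  iter tail : ℕ → List Letter
  iter zero    = [ a ]
  iter (suc k) = τ* (iter k)
  tail zero    = [ b ]
  tail (suc k) = τ* (tail k)

  iter-suc : ∀ k → iter (suc k) ≡ iter k ++ tail k
  iter-suc zero    = refl
  iter-suc (suc k) =
    trans (cong τ* (iter-suc k)) (concatMap-++ τ (iter k) (tail k))

  length-τ* : ∀ xs → length xs ≤ length (τ* xs)
  length-τ* []       = z≤n
  length-τ* (a ∷ xs) = s≤s (m≤n⇒m≤1+n (length-τ* xs))
  length-τ* (b ∷ xs) = s≤s (m≤n⇒m≤1+n (length-τ* xs))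
  length-τ* (c ∷ xs) = s≤s (length-τ* xs)

  length-tail : ∀ k → 1 ≤ length (tail k)
  length-tail zero    = ≤-refl
  length-tail (suc k) = ≤-trans (length-tail k) (length-τ* (tail k))

  length-iter : ∀ k → k < length (iter k)
  length-iter zero    = ≤-refl
  length-iter (suc k) rewrite iter-suc k | length-++ (iter k) {tail k}
                            | +-comm (length (iter k)) (length (tail k))
    = +-mono-≤ (length-tail k) (length-iter k)

  at : List Letter → ℕ → Letter
  at []       _       = a
  at (x ∷ xs) zero    = x
  at (x ∷ xs) (suc i) = at xs i

  at-++ : ∀ xs ys {i} → i < length xs → at (xs ++ ys) i ≡ at xs i
  at-++ (x ∷ xs) ys {zero}  _       = refl
  at-++ (x ∷ xs) ys {suc i} (s≤s p) = at-++ xs ys p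

  prefix-cong : ∀ {w w′ : InfWord} n → (∀ i → i < n → w i ≡ w′ i) →
                prefix w n ≡ prefix w′ n
  prefix-cong zero    e = refl
  prefix-cong (suc n) e =
    cong₂ _∷_ (e 0 z<s) (prefix-cong n λ i i<n → e (suc i) (s<s i<n))

  prefix-at : ∀ xs → prefix (at xs) (length xs) ≡ xs
  prefix-at []       = refl
  prefix-at (x ∷ xs) = cong (x ∷_) (prefix-at xs)

  prefix-at-++ : ∀ xs ys → prefix (at (xs ++ ys)) (length xs) ≡ xs
  prefix-at-++ xs ys =
    trans (prefix-cong (length xs) λ _ → at-++ xs ys) (prefix-at xs)

  prefix-+ : ∀ (w : InfWord) m n → ∃[ r ] prefix w (m + n) ≡ prefix w m ++ r
  prefix-+ w zero    n = prefix w n , refl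
  prefix-+ w (suc m) n with r , e ← prefix-+ (λ i → w (suc i)) m n =
    r , cong (w 0 ∷_) e

  T : InfWord
  T i = at (iter i) i

  at-iter-+ : ∀ k i d → i < length (iter k) → at (iter (d + k)) i ≡ at (iter k) i
  at-iter-+ k i zero    p = refl
  at-iter-+ k i (suc d) p rewrite iter-suc (d + k) =
    trans (at-++ (iter (d + k)) (tail (d + k)) (≤-trans p (mono d)))
          (at-iter-+ k i d p)
    where
    mono : ∀ d → length (iter k) ≤ length (iter (d + k))
    mono zero    = ≤-refl
    mono (suc d) = ≤-trans (mono d) (length-τ* (iter (d + k)))

  T-at : ∀ k i → i < length (iter k) → T i ≡ at (iter k) i
  T-at k i p = trans (sym (at-iter-+ i i k (length-iter i)))
    (trans (cong (λ m → at (iter m) i) (+-comm k i)) (at-iter-+ k i i p))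

  T-iter : ∀ k → prefix T (length (iter k)) ≡ iter k
  T-iter k = trans (prefix-cong (length (iter k)) (T-at k)) (prefix-at (iter k))

  T-initial : ∀ k xs ys → iter k ≡ xs ++ ys → prefix T (length xs) ≡ xs
  T-initial k xs ys e = trans
    (prefix-cong (length xs) λ i p →
      trans (T-at k i (≤-trans p len)) (cong (λ zs → at zs i) e))
    (prefix-at-++ xs ys)
    where
    len : length xs ≤ length (iter k)
    len rewrite e | length-++ xs {ys} = m≤m+n _ _

  T-fixed : IsFixedPoint T
  T-fixed n
    with r , e ← prefix-+ T n (length (iter n) ∸ n)
    rewrite m+[n∸m]≡n (<⇒≤ (length-iter n)) =
    sym (T-initial (suc n) (τ* (prefix T n)) (τ* r)
      (trans (cong τ* (trans (sym (T-iter n)) e))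
             (concatMap-++ τ (prefix T n) r)))

  count-a-τ* : ∀ xs → count a (τ* xs) ≡ length xs
  count-a-τ* []       = refl
  count-a-τ* (a ∷ xs) = cong suc (count-a-τ* xs)
  count-a-τ* (b ∷ xs) = cong suc (count-a-τ* xs)
  count-a-τ* (c ∷ xs) = cong suc (count-a-τ* xs)

  count-b-τ* : ∀ xs → count b (τ* xs) ≡ count a xs
  count-b-τ* []       = refl
  count-b-τ* (a ∷ xs) = cong suc (count-b-τ* xs)
  count-b-τ* (b ∷ xs) = count-b-τ* xs
  count-b-τ* (c ∷ xs) = count-b-τ* xs

  count-c-τ* : ∀ xs → count c (τ* xs) ≡ count b xs
  count-c-τ* []       = refl
  count-c-τ* (a ∷ xs) = count-c-τ* xs
  count-c-τ* (b ∷ xs) = cong suc (count-c-τ* xs)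
  count-c-τ* (c ∷ xs) = count-c-τ* xs

  iter-a : ∀ n → n ≤ count a (iter (suc n))
  iter-a n rewrite count-a-τ* (iter n) = <⇒≤ (length-iter n)

  iter-b : ∀ n → n ≤ count b (iter (2 + n))
  iter-b n rewrite count-b-τ* (iter (suc n)) = iter-a n

  iter-c : ∀ n → n ≤ count c (iter (3 + n))
  iter-c n rewrite count-c-τ* (iter (2 + n)) = iter-b n

  T-unbounded : ∀ x n → ∃[ N ] n ≤ count x (prefix T N)
  T-unbounded a n =
    length (iter (suc n)) , subst (λ xs → n ≤ count a xs)
      (sym (T-iter (suc n))) (iter-a n)
  T-unbounded b n =
    length (iter (2 + n)) , subst (λ xs → n ≤ count b xs)
      (sym (T-iter (2 + n))) (iter-b n)
  T-unbounded c n =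
    length (iter (3 + n)) , subst (λ xs → n ≤ count c xs)
      (sym (T-iter (3 + n))) (iter-c n)

  count-++ : ∀ x xs ys → count x (xs ++ ys) ≡ count x xs + count x ys
  count-++ x xs ys =
    trans (cong length (filter-++ (x ≟_) xs ys)) (length-++ (filter (x ≟_) xs))

  count-suc : ∀ (w : InfWord) x N →
    count x (prefix w (suc N)) ≡ count x (prefix w N) + count x [ w N ]
  count-suc w x N = trans (cong (count x) (sym (applyUpTo-∷ʳ w N)))
                          (count-++ x (prefix w N) [ w N ])

  find : ∀ (w : InfWord) x n N → 0 < n → n ≤ count x (prefix w N) →
         ∃ (IsOccurrence w x n)
  find w x n zero    0<n n≤ with () ← ≤-trans 0<n n≤
  find w x n (suc N) 0<n n≤ with n ≤? count x (prefix w N)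
  ... | yes p = find w x n N 0<n p
  ... | no ¬p with x ≟ w N | count-suc w x N
  ...   | yes e | s = suc N , N , refl , sym e ,
    ≤-antisym (≤-trans (≤-reflexive (trans s (+-comm _ 1))) (≰⇒> ¬p)) n≤
  ...   | no _  | s = ⊥-elim (¬p (≤-trans n≤ (≤-reflexive (trans s (+-identityʳ _)))))

  T-occurs : ∀ x n → 0 < n → ∃ (IsOccurrence T x n)
  T-occurs x n 0<n with N , n≤ ← T-unbounded x n = find T x n N 0<n n≤

  occ : Letter → ℕ → ℕ
  occ x zero    = 0
  occ x (suc n) = proj₁ (T-occurs x (suc n) z<s)

  occ-spec : ∀ x → IsOccurrenceSequence T x (occ x)
  occ-spec x = record
    { at-zero = refl
    ; at-pos  = λ { (suc n) _ → proj₂ (T-occurs x (suc n) z<s) }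
    }

tribonacci-exists :
  ∃[ w ] IsTribonacci w × (∀ x → ∃ (IsOccurrenceSequence w x))
tribonacci-exists = T , (refl , T-fixed) , λ x → occ x , occ-spec x

{-# OPTIONS --safe #-}
module Submission where

-- Write n = m + 1 and u = t₁⋯tₘ.  Since T is fixed by τ, it is the
-- concatenation of the blocks τ(t), of the blocks τ²(t) and of the blocks
-- τ³(t), with t running through its letters.  Every block τ(t) contains one a,
-- every τ²(t) one b and every τ³(t) one c, and these blocks begin with a, ab
-- and abac respectively.  Hence
--
--   Aₙ = 1 + |τ(u)|,   Bₙ = 2 + |τ²(u)|,   Cₙ = 4 + |τ³(u)|
--
-- (`A-formula`, `B-formula`, `C-formula`).  As |τ(v)| = |v| + #a(v) + #b(v),
-- it follows that, with X'ₙ = n + #a(u) and M'ₙ = n + #b(u),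
--
--   Aₙ + n = X'ₙ + M'ₙ,   Bₙ = Aₙ + X'ₙ,   Cₙ = Aₙ + Bₙ + n.
--
-- For any letter x of any word, put F n = n + #x(t₁⋯tₙ₋₁) and let f n be the
-- index of the nth x.  Then F increases by 1 at each step, except that it
-- increases by 2 after each index f i; the value skipped there is f i + i.  So
-- F n is the mex of 0 and the values F i and f i + i with i < n (`shift-isMex`).
-- For x = a and x = b this says that X'ₙ, Aₙ + n, M'ₙ, Bₙ + n satisfy the mex
-- recursion, which has only one solution (`mexSystem-unique`).  Thus
-- Xₙ = X'ₙ = Bₙ - Aₙ, Yₙ = Aₙ + n = Cₙ - Bₙ, Pₙ = Bₙ + n = Cₙ - Aₙ, and
-- Mₙ = Yₙ - Xₙ.

open import Defs
open import Data.Nat.Base using (ℕ)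
open import Data.Integer.Base using (+_; _+_; _-_; _*_)
open import Data.Product.Base using (_×_)
open import Relation.Binary.PropositionalEquality using (_≡_)

open import Data.Empty using (⊥-elim)
open import Data.Integer.Properties using (pos-+)
import Data.Integer.Tactic.RingSolver as ℤ-Solver
open import Data.List.Base using (List; []; _∷_; [_]; _++_; filter; length)
open import Data.List.Properties
  using (∷-injectiveˡ; ∷-injectiveʳ; ++-assoc; concatMap-++; filter-++;
         filter-accept; filter-reject; length-++; length-filter; length-applyUpTo; applyUpTo-∷ʳ)
import Data.Nat.Base as ℕ
open import Data.Nat.Base using (zero; suc; _≤_; _<_; s≤s; z<s)
open import Data.Nat.Induction using (<-rec)
import Data.Nat.Properties as ℕ
import Data.Nat.Tactic.RingSolver as ℕ-Solver
open import Data.Product.Base using (∃-syntax; _,_; proj₁; proj₂)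
open import Data.Sum.Base using (inj₁; inj₂)
open import Level using (0ℓ)
open import Relation.Binary.Definitions using (tri<; tri≈; tri>)
open import Relation.Binary.PropositionalEquality
  using (_≢_; refl; sym; trans; cong; cong₂; subst; subst₂)
open import Relation.Nullary.Decidable using (yes; no)
open import Relation.Unary using (Pred; _∉_; _⊆_)

-- Uniqueness of the mex recursion

IsMex-unique : ∀ {S S′ : Pred ℕ 0ℓ} {m m′} → S ⊆ S′ → S′ ⊆ S →
               IsMex S m → IsMex S′ m′ → m ≡ m′
IsMex-unique to from (m∉ , least) (m′∉ , least′) =
  ℕ.≤-antisym (least _ λ m′∈ → m′∉ (to m′∈)) (least′ _ λ m∈ → m∉ (from m∈))

Earlier-⊆ : ∀ {U V U′ V′ : ℕ → ℕ} {n} →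
            (∀ {i} → i < n → U i ≡ U′ i) → (∀ {i} → i < n → V i ≡ V′ i) →
            Earlier U V n ⊆ Earlier U′ V′ n
Earlier-⊆ U≡ V≡ (i , i<n , inj₁ e) = i , i<n , inj₁ (trans e (U≡ i<n))
Earlier-⊆ U≡ V≡ (i , i<n , inj₂ e) = i , i<n , inj₂ (trans e (V≡ i<n))

mexSystem-unique :
  ∀ {X Y M P X′ Y′ M′ P′} → IsMexSystem X Y M P → IsMexSystem X′ Y′ M′ P′ →
  ∀ n → X n ≡ X′ n × Y n ≡ Y′ n × M n ≡ M′ n × P n ≡ P′ n
mexSystem-unique {X} {Y} {M} {P} {X′} {Y′} {M′} {P′} S S′ = <-rec Agree step
  where
  module S  = IsMexSystem S
  module S′ = IsMexSystem S′

  Agree : ℕ → Set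
  Agree n = X n ≡ X′ n × Y n ≡ Y′ n × M n ≡ M′ n × P n ≡ P′ n

  step : ∀ n → (∀ {i} → i < n → Agree i) → Agree n
  step zero _ = trans S.X₀ (sym S′.X₀) , trans S.Y₀ (sym S′.Y₀)
              , trans S.M₀ (sym S′.M₀) , trans S.P₀ (sym S′.P₀)
  step n@(suc _) ih = X≡ , Y≡ , M≡ , P≡
    where
    X≡ᵢ : ∀ {i} → i < n → X i ≡ X′ i
    X≡ᵢ p = proj₁ (ih p)
    Y≡ᵢ : ∀ {i} → i < n → Y i ≡ Y′ i
    Y≡ᵢ p = proj₁ (proj₂ (ih p))
    M≡ᵢ : ∀ {i} → i < n → M i ≡ M′ i
    M≡ᵢ p = proj₁ (proj₂ (proj₂ (ih p)))
    P≡ᵢ : ∀ {i} → i < n → P i ≡ P′ i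
    P≡ᵢ p = proj₂ (proj₂ (proj₂ (ih p)))

    X≡ : X n ≡ X′ n
    X≡ = IsMex-unique
      (Earlier-⊆ X≡ᵢ Y≡ᵢ)
      (Earlier-⊆ (λ p → sym (X≡ᵢ p)) (λ p → sym (Y≡ᵢ p)))
      (S.Xₙ n z<s) (S′.Xₙ n z<s)
    M≡ : M n ≡ M′ n
    M≡ = IsMex-unique
      (Earlier-⊆ M≡ᵢ P≡ᵢ)
      (Earlier-⊆ (λ p → sym (M≡ᵢ p)) (λ p → sym (P≡ᵢ p)))
      (S.Mₙ n z<s) (S′.Mₙ n z<s)
    Y≡ : Y n ≡ Y′ n
    Y≡ = trans (S.Yₙ n z<s) (trans (cong₂ ℕ._+_ X≡ M≡) (sym (S′.Yₙ n z<s)))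
    P≡ : P n ≡ P′ n
    P≡ = trans (S.Pₙ n z<s) (trans (cong₂ ℕ._+_ X≡ Y≡) (sym (S′.Pₙ n z<s)))

-- Counting letters and locating occurrences

count-++ : ∀ x xs ys → count x (xs ++ ys) ≡ count x xs ℕ.+ count x ys
count-++ x xs ys =
  trans (cong length (filter-++ (x ≟_) xs ys)) (length-++ (filter (x ≟_) xs))

count-suc : ∀ (w : InfWord) x n →
  count x (prefix w (suc n)) ≡ count x (prefix w n) ℕ.+ count x [ w n ]
count-suc w x n = trans (cong (count x) (sym (applyUpTo-∷ʳ w n)))
                        (count-++ x (prefix w n) [ w n ])

count-hit : ∀ (w : InfWord) {x n} → w n ≡ x →
            count x (prefix w (suc n)) ≡ suc (count x (prefix w n))
count-hit w {x} {n} e = trans (count-suc w x n) (trans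
  (cong (λ k → count x (prefix w n) ℕ.+ length k) (filter-accept (x ≟_) (sym e)))
  (ℕ.+-comm _ 1))

count-miss : ∀ (w : InfWord) {x n} → x ≢ w n →
             count x (prefix w (suc n)) ≡ count x (prefix w n)
count-miss w {x} {n} x≢ = trans (count-suc w x n) (trans
  (cong (λ k → count x (prefix w n) ℕ.+ length k) (filter-reject (x ≟_) x≢))
  (ℕ.+-identityʳ _))

count-mono : ∀ (w : InfWord) x {m n} → m ≤ n →
             count x (prefix w m) ≤ count x (prefix w n)
count-mono w x {m} {n} m≤n with ℕ.m≤n⇒m<n∨m≡n m≤n
... | inj₂ refl = ℕ.≤-refl
count-mono w x {m} {suc n} _ | inj₁ (s≤s m≤n) =
  ℕ.≤-trans (count-mono w x m≤n)
    (ℕ.≤-trans (ℕ.m≤m+n _ _) (ℕ.≤-reflexive (sym (count-suc w x n))))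

count-prefix≤ : ∀ (w : InfWord) x n → count x (prefix w n) ≤ n
count-prefix≤ w x n = ℕ.≤-trans (length-filter (x ≟_) (prefix w n))
                                (ℕ.≤-reflexive (length-applyUpTo w n))

occurrence-unique : ∀ {w x n i i′} →
  IsOccurrence w x n i → IsOccurrence w x n i′ → i ≡ i′
occurrence-unique {w} {x} (j , refl , wj , cj) (j′ , refl , wj′ , cj′)
  with ℕ.<-cmp j j′
... | tri≈ _ refl _ = refl
... | tri< j<j′ _ _ = ⊥-elim (ℕ.1+n≰n (ℕ.≤-trans
  (ℕ.≤-reflexive (sym (trans (trans cj (sym cj′)) (count-hit w wj′))))
  (count-mono w x j<j′)))
... | tri> _ _ j′<j = ⊥-elim (ℕ.1+n≰n (ℕ.≤-trans
  (ℕ.≤-reflexive (sym (trans (trans cj′ (sym cj)) (count-hit w wj))))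
  (count-mono w x j′<j)))

occurrence-at : ∀ {w x f n i m} → IsOccurrenceSequence w x f →
                IsOccurrence w x n i → n ≡ suc m → f (suc m) ≡ i
occurrence-at {w} {x} {m = m} occ at refl =
  occurrence-unique {w} {x} (IsOccurrenceSequence.at-pos occ (suc m) z<s) at

-- The complementary pair attached to a letter

-- The number n + #x(t₁⋯tₙ₋₁) for n > 0, and 0 for n = 0.
shift : InfWord → Letter → ℕ → ℕ
shift w x zero    = 0
shift w x (suc m) = suc m ℕ.+ count x (prefix w m)

shift-< : ∀ w x n → shift w x n < shift w x (suc n)
shift-< w x zero    = z<s
shift-< w x (suc m) = ℕ.+-mono-≤ {suc (suc m)} ℕ.≤-refl (count-mono w x (ℕ.n≤1+n m))

shift-mono : ∀ w x {m n} → m ≤ n → shift w x m ≤ shift w x n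
shift-mono w x {m} {n} m≤n with ℕ.m≤n⇒m<n∨m≡n m≤n
... | inj₂ refl = ℕ.≤-refl
shift-mono w x {m} {suc n} _ | inj₁ (s≤s m≤n) =
  ℕ.≤-trans (shift-mono w x m≤n) (ℕ.<⇒≤ (shift-< w x n))

module _ {w : InfWord} {x : Letter} {f : ℕ → ℕ}
         (occ : IsOccurrenceSequence w x f) where

  open IsOccurrenceSequence occ

  private
    F G : ℕ → ℕ
    F   = shift w x
    G n = f n ℕ.+ n

  -- For i > 0 the value G i lies strictly between F (f i) and F (f i + 1).
  shift≢ : ∀ n i → 0 < n → F n ≢ G i
  shift≢ (suc m) zero _ e with () ← trans e (cong (ℕ._+ 0) at-zero)
  shift≢ n (suc i) _ e with j , fi , wj , cj ← at-pos (suc i) z<s = contra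
    where
    cj′ : count x (prefix w j) ≡ i
    cj′ = ℕ.suc-injective (trans (sym (count-hit w wj))
      (subst (λ l → count x (prefix w l) ≡ suc i) fi cj))

    F≡ : F n ≡ suc (F (suc j))
    F≡ = trans e (trans (cong (ℕ._+ suc i) fi)
           (trans (ℕ.+-suc (suc j) i) (cong (λ k → suc (suc j ℕ.+ k)) (sym cj′))))

    F₂ : F (suc (suc j)) ≡ suc (suc (F (suc j)))
    F₂ = trans (cong (λ k → suc (suc j) ℕ.+ k) (count-hit w wj))
               (ℕ.+-suc (suc (suc j)) _)

    contra : _
    contra with ℕ.<-cmp n (suc j)
    ... | tri< n<1+j _ _ = ℕ.1+n≰n (ℕ.≤-trans (ℕ.≤-reflexive (sym F≡))
                             (shift-mono w x (ℕ.<⇒≤ n<1+j)))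
    ... | tri≈ _ refl _  = ℕ.1+n≰n (ℕ.≤-reflexive (sym F≡))
    ... | tri> _ _ 1+j<n = ℕ.1+n≰n (ℕ.≤-trans (ℕ.≤-reflexive (sym F₂))
                             (ℕ.≤-trans (shift-mono w x 1+j<n) (ℕ.≤-reflexive F≡)))

  below-shift : ∀ m {k} → k < F (suc m) → Earlier F G (suc m) k
  below-shift zero {zero} _ = 0 , z<s , inj₁ refl
  below-shift zero {suc k} (s≤s ())
  below-shift (suc m) {k} k<F with ℕ.<-cmp k (F (suc m))
  ... | tri< k<F′ _ _ with i , i<n , e ← below-shift m k<F′ =
    i , ℕ.m<n⇒m<1+n i<n , e
  ... | tri≈ _ e _ = suc m , ℕ.≤-refl , inj₁ e
  ... | tri> _ _ F<k with x ≟ w m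
  ...   | no x≢ = ⊥-elim (ℕ.1+n≰n (ℕ.≤-trans (ℕ.<-≤-trans (s≤s F<k) k<F)
    (ℕ.≤-reflexive (cong (λ c → suc (suc m) ℕ.+ c) (count-miss w x≢)))))
  -- Here t_{m+1} = x, and k is the one value between F (m + 1) and F (m + 2).
  ...   | yes refl = i , s≤s (count-prefix≤ w x (suc m)) , inj₂ k≡
    where
    i : ℕ
    i = count x (prefix w (suc m))

    hit : i ≡ suc (count x (prefix w m))
    hit = count-hit w refl

    fi : f i ≡ suc m
    fi = occurrence-unique (at-pos i (subst (0 <_) (sym hit) z<s))
                           (m , refl , refl , refl)

    k≡ : k ≡ G i
    k≡ = trans
      (ℕ.≤-antisym (ℕ.≤-pred k<F)
        (subst (_≤ k) (sym (trans (cong (suc m ℕ.+_) hit) (ℕ.+-suc (suc m) _))) F<k))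
      (cong (ℕ._+ i) (sym fi))

  -- The positive values of F and G partition the positive integers, and every
  -- G i below F n has i < n; so F n is the least number not yet listed.
  shift-isMex : ∀ n → 0 < n → IsMex (Earlier F G n) (F n)
  shift-isMex n@(suc m) _ = ∉ , λ k k∉ → ℕ.≮⇒≥ λ k<F → k∉ (below-shift m k<F)
    where
    ∉ : F n ∉ Earlier F G n
    ∉ (i , i<n , inj₁ e) = ℕ.<⇒≢
      (ℕ.<-≤-trans (shift-< w x i) (shift-mono w x i<n)) (sym e)
    ∉ (i , i<n , inj₂ e) = shift≢ n i z<s e

-- The morphism: lengths and letter counts

length-τ* : ∀ xs → length (τ* xs) ≡ length xs ℕ.+ count a xs ℕ.+ count b xs
length-τ* []       = refl
length-τ* (a ∷ xs) rewrite length-τ* xs =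
  cong (λ k → suc (k ℕ.+ count b xs)) (sym (ℕ.+-suc (length xs) (count a xs)))
length-τ* (b ∷ xs) rewrite length-τ* xs =
  cong suc (sym (ℕ.+-suc (length xs ℕ.+ count a xs) (count b xs)))
length-τ* (c ∷ xs) = cong suc (length-τ* xs)

count-a-τ* : ∀ xs → count a (τ* xs) ≡ length xs
count-a-τ* []       = refl
count-a-τ* (a ∷ xs) = cong suc (count-a-τ* xs)
count-a-τ* (b ∷ xs) = cong suc (count-a-τ* xs)
count-a-τ* (c ∷ xs) = cong suc (count-a-τ* xs)

count-b-τ* : ∀ xs → count b (τ* xs) ≡ count a xs
count-b-τ* []       = refl
count-b-τ* (a ∷ xs) = cong suc (count-b-τ* xs)
count-b-τ* (b ∷ xs) = count-b-τ* xs
count-b-τ* (c ∷ xs) = count-b-τ* xs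

count-c-τ* : ∀ xs → count c (τ* xs) ≡ count b xs
count-c-τ* []       = refl
count-c-τ* (a ∷ xs) = count-c-τ* xs
count-c-τ* (b ∷ xs) = cong suc (count-c-τ* xs)
count-c-τ* (c ∷ xs) = count-c-τ* xs

length-τ*² : ∀ xs → length (τ* (τ* xs)) ≡ length (τ* xs) ℕ.+ length xs ℕ.+ count a xs
length-τ*² xs rewrite length-τ* (τ* xs) | count-a-τ* xs | count-b-τ* xs = refl

length-τ*³ : ∀ xs →
  length (τ* (τ* (τ* xs))) ≡ length (τ* (τ* xs)) ℕ.+ length (τ* xs) ℕ.+ length xs
length-τ*³ xs rewrite length-τ*² (τ* xs) | count-a-τ* xs = refl

-- Occurrences in a fixed point of the morphism

-- The finite word xs is an initial segment of w.
IsInitial : InfWord → List Letter → Set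
IsInitial w xs = prefix w (length xs) ≡ xs

initial-split : ∀ (w : InfWord) xs {y ys} → IsInitial w (xs ++ y ∷ ys) →
                IsInitial w xs × w (length xs) ≡ y
initial-split w []       e = refl , ∷-injectiveˡ e
initial-split w (x ∷ xs) e
  with e₁ , e₂ ← initial-split (λ i → w (suc i)) xs (∷-injectiveʳ e) =
  cong₂ _∷_ (∷-injectiveˡ e) e₁ , e₂

initial-occurrence : ∀ {w : InfWord} xs {y ys} → IsInitial w (xs ++ y ∷ ys) →
                     IsOccurrence w y (suc (count y xs)) (suc (length xs))
initial-occurrence {w} xs {y} e with e₁ , e₂ ← initial-split w xs e =
  length xs , refl , e₂ ,
  trans (count-hit w e₂) (cong (λ zs → suc (count y zs)) e₁)

-- The occurrence of y that follows the initial segment xs ++ v, where v does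
-- not contain y.
block-occurrence : ∀ {w : InfWord} xs v {y ys zs} → IsInitial w (xs ++ zs) →
  zs ≡ v ++ y ∷ ys → count y v ≡ 0 →
  IsOccurrence w y (suc (count y xs)) (suc (length v) ℕ.+ length xs)
block-occurrence {w} xs v {y} {ys} e refl v∌y =
  subst₂ (λ n l → IsOccurrence w y (suc n) (suc l))
    (trans (count-++ y xs v) (trans (cong (count y xs ℕ.+_) v∌y) (ℕ.+-identityʳ _)))
    (trans (length-++ xs) (ℕ.+-comm (length xs) (length v)))
    (initial-occurrence (xs ++ v)
      (subst (IsInitial w) (sym (++-assoc xs v (y ∷ ys))) e))

module _ {w : InfWord} (fixed : IsFixedPoint w) where

  τ*-initial : ∀ {xs} → IsInitial w xs → IsInitial w (τ* xs)
  τ*-initial {xs} e = subst (λ ys → prefix w (length (τ* ys)) ≡ τ* ys) e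
                            (sym (fixed (length xs)))

  τ-blocks : ∀ m → IsInitial w (τ* (prefix w m) ++ τ* [ w m ])
  τ-blocks m = subst (IsInitial w)
    (trans (cong τ* (sym (applyUpTo-∷ʳ w m))) (concatMap-++ τ (prefix w m) [ w m ]))
    (sym (fixed (suc m)))

  τ²-blocks : ∀ m → IsInitial w (τ* (τ* (prefix w m)) ++ τ* (τ* [ w m ]))
  τ²-blocks m = subst (IsInitial w)
    (concatMap-++ τ (τ* (prefix w m)) (τ* [ w m ])) (τ*-initial (τ-blocks m))

  τ³-blocks : ∀ m →
    IsInitial w (τ* (τ* (τ* (prefix w m))) ++ τ* (τ* (τ* [ w m ])))
  τ³-blocks m = subst (IsInitial w)
    (concatMap-++ τ (τ* (τ* (prefix w m))) (τ* (τ* [ w m ])))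
    (τ*-initial (τ²-blocks m))

  private
    τ-begins : ∀ t → ∃[ r ] τ* [ t ] ≡ a ∷ r
    τ-begins a = _ , refl
    τ-begins b = _ , refl
    τ-begins c = _ , refl

    τ²-begins : ∀ t → ∃[ r ] τ* (τ* [ t ]) ≡ a ∷ b ∷ r
    τ²-begins a = _ , refl
    τ²-begins b = _ , refl
    τ²-begins c = _ , refl

    τ³-begins : ∀ t → ∃[ r ] τ* (τ* (τ* [ t ])) ≡ a ∷ b ∷ a ∷ c ∷ r
    τ³-begins a = _ , refl
    τ³-begins b = _ , refl
    τ³-begins c = _ , refl

  A-formula : ∀ {A} → IsOccurrenceSequence w a A →
              ∀ m → A (suc m) ≡ 1 ℕ.+ length (τ* (prefix w m))
  A-formula occ m = occurrence-at occ
    (block-occurrence (τ* (prefix w m)) [] (τ-blocks m)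
      (proj₂ (τ-begins (w m))) refl)
    (cong suc (trans (count-a-τ* (prefix w m)) (length-applyUpTo w m)))

  B-formula : ∀ {B} → IsOccurrenceSequence w b B →
              ∀ m → B (suc m) ≡ 2 ℕ.+ length (τ* (τ* (prefix w m)))
  B-formula occ m = occurrence-at occ
    (block-occurrence (τ* (τ* (prefix w m))) (a ∷ []) (τ²-blocks m)
      (proj₂ (τ²-begins (w m))) refl)
    (cong suc (trans (count-b-τ* (τ* (prefix w m)))
      (trans (count-a-τ* (prefix w m)) (length-applyUpTo w m))))

  C-formula : ∀ {C} → IsOccurrenceSequence w c C →
              ∀ m → C (suc m) ≡ 4 ℕ.+ length (τ* (τ* (τ* (prefix w m))))
  C-formula occ m = occurrence-at occ
    (block-occurrence (τ* (τ* (τ* (prefix w m)))) (a ∷ b ∷ a ∷ []) (τ³-blocks m)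
      (proj₂ (τ³-begins (w m))) refl)
    (cong suc (trans (count-c-τ* (τ* (τ* (prefix w m))))
      (trans (count-b-τ* (τ* (prefix w m)))
        (trans (count-a-τ* (prefix w m)) (length-applyUpTo w m)))))

  -- Linear relations between the occurrence sequences

  module _ {A B : ℕ → ℕ}
           (occA : IsOccurrenceSequence w a A)
           (occB : IsOccurrenceSequence w b B) where

    private
      module A = IsOccurrenceSequence occA
      module B = IsOccurrenceSequence occB

    A+n≡shifts : ∀ n → A n ℕ.+ n ≡ shift w a n ℕ.+ shift w b n
    A+n≡shifts zero = cong (ℕ._+ 0) A.at-zero
    A+n≡shifts (suc m)
      rewrite A-formula occA m | length-τ* (prefix w m) | length-applyUpTo w m =
      arith m (count a (prefix w m)) (count b (prefix w m))
      where
      arith : ∀ m p q → suc (m ℕ.+ p ℕ.+ q) ℕ.+ suc m ≡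
                        (suc m ℕ.+ p) ℕ.+ (suc m ℕ.+ q)
      arith = ℕ-Solver.solve-∀

    B≡A+shift : ∀ n → B n ≡ A n ℕ.+ shift w a n
    B≡A+shift zero = trans B.at-zero (cong (ℕ._+ 0) (sym A.at-zero))
    B≡A+shift (suc m)
      rewrite A-formula occA m | B-formula occB m | length-τ*² (prefix w m)
            | length-applyUpTo w m =
      arith m (length (τ* (prefix w m))) (count a (prefix w m))
      where
      arith : ∀ m l p → 2 ℕ.+ (l ℕ.+ m ℕ.+ p) ≡ suc l ℕ.+ (suc m ℕ.+ p)
      arith = ℕ-Solver.solve-∀

    shift-mexSystem : IsMexSystem (shift w a) (λ n → A n ℕ.+ n)
                                  (shift w b) (λ n → B n ℕ.+ n)
    shift-mexSystem = record
      { X₀ = refl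
      ; Y₀ = cong (ℕ._+ 0) A.at-zero
      ; M₀ = refl
      ; P₀ = cong (ℕ._+ 0) B.at-zero
      ; Xₙ = shift-isMex occA
      ; Mₙ = shift-isMex occB
      ; Yₙ = λ n _ → A+n≡shifts n
      ; Pₙ = λ n _ → trans (cong (ℕ._+ n) (B≡A+shift n))
                           (arith (A n) (shift w a n) n)
      }
      where
      arith : ∀ p q n → p ℕ.+ q ℕ.+ n ≡ q ℕ.+ (p ℕ.+ n)
      arith = ℕ-Solver.solve-∀

    C≡A+B+n : ∀ {C} → IsOccurrenceSequence w c C → ∀ n → C n ≡ A n ℕ.+ B n ℕ.+ n
    C≡A+B+n occC zero = trans (IsOccurrenceSequence.at-zero occC)
      (cong₂ (λ p q → p ℕ.+ q ℕ.+ 0) (sym A.at-zero) (sym B.at-zero))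
    C≡A+B+n occC (suc m)
      rewrite A-formula occA m | B-formula occB m | C-formula occC m
            | length-τ*³ (prefix w m) | length-applyUpTo w m =
      arith (length (τ* (τ* (prefix w m)))) (length (τ* (prefix w m))) m
      where
      arith : ∀ k l m → 4 ℕ.+ (k ℕ.+ l ℕ.+ m) ≡ suc l ℕ.+ (2 ℕ.+ k) ℕ.+ suc m
      arith = ℕ-Solver.solve-∀

-- Passage to differences of integers

+-difference : ∀ {k l d} → l ≡ k ℕ.+ d → + d ≡ + l - + k
+-difference {k} {d = d} refl = trans (arith (+ k) (+ d)) (cong (_- + k) (sym (pos-+ k d)))
  where
  arith : ∀ k d → d ≡ k + d - k
  arith = ℤ-Solver.solve-∀

corollary21 : (X Y M P : ℕ → ℕ) → IsMexSystem X Y M P →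
    (T : InfWord) → IsTribonacci T →
    (A B C : ℕ → ℕ) →
    IsOccurrenceSequence T a A →
    IsOccurrenceSequence T b B →
    IsOccurrenceSequence T c C →
    ∀ n →
    (+ X n ≡ + B n - + A n) ×
    (+ Y n ≡ + C n - + B n) ×
    (+ M n ≡ + C n - + 2 * + B n + + A n) ×
    (+ P n ≡ + C n - + A n)
corollary21 X Y M P S T (_ , fixed) A B C occA occB occC n
  with X≡ , Y≡ , M≡ , P≡ ← mexSystem-unique S (shift-mexSystem fixed occA occB) n
  = X-diff , Y-diff , M-diff , P-diff
  where
  C≡ : C n ≡ A n ℕ.+ B n ℕ.+ n
  C≡ = C≡A+B+n fixed occA occB occC n

  X-diff : + X n ≡ + B n - + A n
  X-diff = +-difference
    (trans (B≡A+shift fixed occA occB n) (cong (A n ℕ.+_) (sym X≡)))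

  Y-diff : + Y n ≡ + C n - + B n
  Y-diff = +-difference
    (trans C≡ (trans (arith (A n) (B n) n) (cong (B n ℕ.+_) (sym Y≡))))
    where
    arith : ∀ p q n → p ℕ.+ q ℕ.+ n ≡ q ℕ.+ (p ℕ.+ n)
    arith = ℕ-Solver.solve-∀

  P-diff : + P n ≡ + C n - + A n
  P-diff = +-difference
    (trans C≡ (trans (ℕ.+-assoc (A n) (B n) n) (cong (A n ℕ.+_) (sym P≡))))

  Y≡X+M : Y n ≡ X n ℕ.+ M n
  Y≡X+M = trans Y≡ (trans (A+n≡shifts fixed occA occB n)
                          (cong₂ ℕ._+_ (sym X≡) (sym M≡)))

  M-diff : + M n ≡ + C n - + 2 * + B n + + A n
  M-diff = trans (+-difference Y≡X+M)
    (trans (cong₂ _-_ Y-diff X-diff) (arith (+ A n) (+ B n) (+ C n)))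
    where
    arith : ∀ p q r → (r - q) - (q - p) ≡ r - + 2 * q + p
    arith = ℤ-Solver.solve-∀
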